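{- Over the alphabet $\{a,b,c\}$, $$\varTheta(a,b,c)=c\cdot \mathbf T(a,b,c),$$ that is, the infinite word $\varTheta$ is obtained by prefixing the Tribonacci word $\mathbf T$ with the letter $c$.
   Context: $\varTheta(a,b,c)$ is the infinite word that is the fixed point of the morphism $\theta: a\to cabaaba,\ b\to cababa,\ c\to caba$; it begins with $c$ and equals $\lim_{k\to\infty}\theta^k(c)$. The Tribonacci word $\mathbf T(a,b,c)$ is the infinite word that is the fixed point of the morphism $\tau: a\to ab,\ b\to ac,\ c\to a$; it begins with $a$ and equals $\lim_{k\to\infty}\tau^k(a)$. The dot denotes concatenation. -}

module Defs where

open import Data.Fin.Base using (fromℕ<)
open import Data.List.Base
  using (List; []; _∷_; [_]; _++_; concatMap; length; lookup; take; applyUpTo)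
open import Data.List.NonEmpty.Base using (List⁺; _∷_; toList)
open import Data.List.Properties using (++-assoc; ++-identityʳ; concatMap-++; length-++)
open import Data.Nat.Base
open import Data.Nat.GeneralisedArithmetic using (fold)
open import Data.Nat.Properties
open import Data.Product.Base using (∃; _,_; proj₁; proj₂)
open import Data.Sum.Base using (inj₁; inj₂)
open import Function.Base using (_∘_)
open import Relation.Binary.PropositionalEquality hiding ([_])

private
  variable
    A : Set

InfWord : Set → Set
InfWord A = ℕ → A

infixr 5 _·_

_·_ : A → InfWord A → InfWord A
(x · w) zero    = x
(x · w) (suc n) = w n

-- Images of letters are nonempty (true of both θ and τ), so that the image of
-- an infinite word is again an infinite word.

Morphism : Set → Set
Morphism A = A → List⁺ A

_⟨_⟩ : Morphism A → List A → List A
f ⟨ w ⟩ = concatMap (toList ∘ f) w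

-- flatten v u is the infinite word v ++ u 0 ++ u 1 ++ ⋯

flatten : List⁺ A → (ℕ → List⁺ A) → InfWord A
flatten (x ∷ _)      u zero    = x
flatten (_ ∷ [])     u (suc n) = flatten (u 0) (u ∘ suc) n
flatten (_ ∷ y ∷ ys) u (suc n) = flatten (y ∷ ys) u n

_⟨_⟩∞ : Morphism A → InfWord A → InfWord A
f ⟨ w ⟩∞ = flatten (f (w 0)) (f ∘ w ∘ suc)

IsFixedPoint : Morphism A → InfWord A → Set
IsFixedPoint f w = f ⟨ w ⟩∞ ≗ w

-- Convergence of finite words to an infinite word in the product topology.

_⟶_ : (ℕ → List A) → InfWord A → Set
u ⟶ w = ∀ n → ∃ λ K → ∀ k → K ≤ k → take n (u k) ≡ applyUpTo w n

iter : Morphism A → A → ℕ → List A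
iter f x k = fold [ x ] (f ⟨_⟩) k

Prolongable : Morphism A → A → Set
Prolongable f x = ∃ λ y → ∃ λ s → f x ≡ x ∷ y ∷ s

infix 4 _⊑_
data _⊑_ {A : Set} : List A → InfWord A → Set where
  []  : ∀ {w} → [] ⊑ w
  _∷_ : ∀ {x p w} → x ≡ w 0 → p ⊑ w ∘ suc → x ∷ p ⊑ w

-- The index of the letter is carried by the type of the bound.

infix 9 _‼_
_‼_ : (p : List A) → ∀ {n} → n < length p → A
p ‼ h = lookup p (fromℕ< h)

⊑-‼ : ∀ {p : List A} {w n} → p ⊑ w → (h : n < length p) → p ‼ h ≡ w n
⊑-‼ {n = zero}  (e ∷ _) _ = e
⊑-‼ {n = suc n} (_ ∷ q) h = ⊑-‼ q (s<s⁻¹ h)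

‼-⊑ : ∀ (p : List A) {w} → (∀ n (h : n < length p) → p ‼ h ≡ w n) → p ⊑ w
‼-⊑ []      _ = []
‼-⊑ (x ∷ p) e = e 0 z<s ∷ ‼-⊑ p (λ n h → e (suc n) (s<s h))

‼-++ : ∀ (p : List A) {q r n} → r ≡ p ++ q →
        (h : n < length p) (h′ : n < length r) → r ‼ h′ ≡ p ‼ h
‼-++ (x ∷ p) {n = zero}  refl h h′ = refl
‼-++ (x ∷ p) {n = suc n} refl h h′ = ‼-++ p refl (s<s⁻¹ h) (s<s⁻¹ h′)

⊑-take : ∀ n {p : List A} {w} → n ≤ length p → p ⊑ w → take n p ≡ applyUpTo w n
⊑-take zero    _ _       = refl
⊑-take (suc n) h (e ∷ q) = cong₂ _∷_ e (⊑-take n (s≤s⁻¹ h) q)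

⊑-flatten : ∀ (x : A) xs {r u} → r ⊑ flatten (u 0) (u ∘ suc) →
            x ∷ xs ++ r ⊑ flatten (x ∷ xs) u
⊑-flatten x []       q = refl ∷ q
⊑-flatten x (y ∷ ys) q = refl ∷ ⊑-flatten y ys q

⊑-image : ∀ (f : Morphism A) {p w} → p ⊑ w → f ⟨ p ⟩ ⊑ f ⟨ w ⟩∞
⊑-image f []                 = []
⊑-image f {w = w} (refl ∷ q) = ⊑-flatten _ _ (⊑-image f q)

⊑-resp : ∀ {p : List A} {v w} → v ≗ w → p ⊑ v → p ⊑ w
⊑-resp e []      = []
⊑-resp e (d ∷ q) = trans d (e 0) ∷ ⊑-resp (e ∘ suc) q

length-⟨⟩ : ∀ (f : Morphism A) w → length w ≤ length (f ⟨ w ⟩)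
length-⟨⟩ f []      = z≤n
length-⟨⟩ f (x ∷ w) = s≤s (≤-trans (length-⟨⟩ f w)
  (≤-trans (m≤n+m _ _) (≤-reflexive (sym (length-++ (List⁺.tail (f x)))))))

module _ (f : Morphism A) (x : A) (pr : Prolongable f x) where

  step : ℕ → List A
  step k = fold (proj₁ pr ∷ proj₁ (proj₂ pr)) (f ⟨_⟩) k

  iter-suc : ∀ k → iter f x (suc k) ≡ iter f x k ++ step k
  iter-suc zero    = trans (++-identityʳ _) (cong toList (proj₂ (proj₂ pr)))
  iter-suc (suc k) = trans (cong (f ⟨_⟩) (iter-suc k))
                           (concatMap-++ (toList ∘ f) (iter f x k) (step k))

  step-nonempty : ∀ k → 0 < length (step k)
  step-nonempty zero    = z<s
  step-nonempty (suc k) = ≤-trans (step-nonempty k) (length-⟨⟩ f (step k))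

  iter-+ : ∀ d k → ∃ λ t → iter f x (d + k) ≡ iter f x k ++ t
  iter-+ zero    k = [] , sym (++-identityʳ _)
  iter-+ (suc d) k with iter-+ d k
  ... | t , e = t ++ step (d + k) ,
    trans (iter-suc (d + k))
          (trans (cong (_++ step (d + k)) e) (++-assoc (iter f x k) t _))

  iter-≤ : ∀ {k l} → k ≤ l → ∃ λ t → iter f x l ≡ iter f x k ++ t
  iter-≤ {k} {l} k≤l with iter-+ (l ∸ k) k
  ... | t , e = t , trans (cong (iter f x) (sym (m∸n+n≡m k≤l))) e

  iter-length : ∀ n → n < length (iter f x n)
  iter-length zero    = z<s
  iter-length (suc n) = begin-strict
    suc n                                   ≤⟨ iter-length n ⟩
    length (iter f x n)                     <⟨ m<m+n _ (step-nonempty n) ⟩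
    length (iter f x n) + length (step n)   ≡⟨ length-++ (iter f x n) ⟨
    length (iter f x n ++ step n)           ≡⟨ cong length (iter-suc n) ⟨
    length (iter f x (suc n))               ∎
    where open ≤-Reasoning

  -- lim fᵏ(x): each fᵏ(x) is a prefix of fᵏ⁺¹(x), and fⁿ(x) has more than n
  -- letters, so letter n of the limit can be read off fⁿ(x).

  limit : InfWord A
  limit n = iter f x n ‼ iter-length n

  iter-⊑ : ∀ k → iter f x k ⊑ limit
  iter-⊑ k = ‼-⊑ (iter f x k) agree
    where
    agree : ∀ n (h : n < length (iter f x k)) → iter f x k ‼ h ≡ limit n
    agree n h with ≤-total n k
    ... | inj₁ n≤k with iter-≤ n≤k
    ...   | t , e = ‼-++ (iter f x n) e (iter-length n) h
    agree n h | inj₂ k≤n with iter-≤ k≤n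
    ...   | t , e = sym (‼-++ (iter f x k) e h (iter-length n))

  limit-converges : iter f x ⟶ limit
  limit-converges n = n , λ k n≤k →
    ⊑-take n (≤-trans n≤k (<⇒≤ (iter-length k))) (iter-⊑ k)

  limit-head : limit 0 ≡ x
  limit-head = refl

  limit-fixed : IsFixedPoint f limit
  limit-fixed n = trans (sym (⊑-‼ (⊑-image f (iter-⊑ n)) h))
                        (⊑-‼ (iter-⊑ (suc n)) h)
    where
    h : n < length (iter f x (suc n))
    h = <-trans (n<1+n n) (iter-length (suc n))

  limit-unique : ∀ w → IsFixedPoint f w → w 0 ≡ x → w ≗ limit
  limit-unique w fixed w0≡x n = sym (⊑-‼ (prefix n) (iter-length n))
    where
    prefix : ∀ k → iter f x k ⊑ w
    prefix zero    = sym w0≡x ∷ []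
    prefix (suc k) = ⊑-resp fixed (⊑-image f (prefix k))

data Letter : Set where
  a b c : Letter

θ : Morphism Letter
θ a = c ∷ a ∷ b ∷ a ∷ a ∷ b ∷ a ∷ []
θ b = c ∷ a ∷ b ∷ a ∷ b ∷ a ∷ []
θ c = c ∷ a ∷ b ∷ a ∷ []

τ : Morphism Letter
τ a = a ∷ b ∷ []
τ b = a ∷ c ∷ []
τ c = a ∷ []

θ-prolongable : Prolongable θ c
θ-prolongable = _ , _ , refl

τ-prolongable : Prolongable τ a
τ-prolongable = _ , _ , refl

Θ : InfWord Letter
Θ = limit θ c θ-prolongable

𝐓 : InfWord Letter
𝐓 = limit τ a τ-prolongable

-- Neither morphism has a fixed point beginning with another letter, so Θ and 𝐓
-- are the only fixed points.

Θ-unique : ∀ w → IsFixedPoint θ w → w ≗ Θ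
Θ-unique w fixed = limit-unique θ c θ-prolongable w fixed (head (w 0) refl)
  where
  head : ∀ x → w 0 ≡ x → w 0 ≡ c
  head a e = trans (sym (fixed 0)) (cong (List⁺.head ∘ θ) e)
  head b e = trans (sym (fixed 0)) (cong (List⁺.head ∘ θ) e)
  head c e = e

𝐓-unique : ∀ w → IsFixedPoint τ w → w ≗ 𝐓
𝐓-unique w fixed = limit-unique τ a τ-prolongable w fixed (head (w 0) refl)
  where
  head : ∀ x → w 0 ≡ x → w 0 ≡ a
  head a e = e
  head b e = trans (sym (fixed 0)) (cong (List⁺.head ∘ τ) e)
  head c e = trans (sym (fixed 0)) (cong (List⁺.head ∘ τ) e)

{-# OPTIONS --safe #-}
module Submission where

-- The morphisms θ and τ³ are conjugate by the word aba: for every finite word w,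
--
--   aba · θ(w) = τ³(w) · aba                                      (conjugate).
--
-- With w = c · p, where τ³(c) = abac, cancelling aba on the left gives
-- θ(c · p) = c · τ³(p) · aba. Let p run through the prefixes τⁿ(a) of 𝐓. Then
-- c · τ³(p) is a prefix of θ(c · 𝐓) by this identity, and of c · 𝐓 because
-- τ³(p) = τⁿ⁺³(a). These common prefixes are arbitrarily long, so c · 𝐓 is a fixed
-- point of θ, and Θ is the only one.

open import Defs
open import Data.List.Base using (List; []; _∷_; _++_; length)
open import Data.Nat.Base using (_+_; _<_)
open import Data.Nat.Properties using (≤-trans; m≤n+m; m≤n⇒m≤1+n)
open import Data.List.Properties using (∷-injectiveʳ)
open import Relation.Binary.PropositionalEquality
  using (_≡_; _≗_; refl; sym; trans; cong; subst)

⊑-++ˡ : ∀ {A : Set} (p : List A) {q w} → p ++ q ⊑ w → p ⊑ w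
⊑-++ˡ []      _       = []
⊑-++ˡ (_ ∷ p) (e ∷ r) = e ∷ ⊑-++ˡ p r

τ³⟨_⟩ : List Letter → List Letter
τ³⟨ w ⟩ = τ ⟨ τ ⟨ τ ⟨ w ⟩ ⟩ ⟩

aba : List Letter
aba = a ∷ b ∷ a ∷ []

-- On a letter x, both sides of aba · θ(x) = τ³(x) · aba compute to the same word.
-- The induction therefore moves aba to the right past one letter image at a time.

conjugate : ∀ w → aba ++ θ ⟨ w ⟩ ≡ τ³⟨ w ⟩ ++ aba
conjugate []      = refl
conjugate (a ∷ w) = cong (τ³⟨ a ∷ [] ⟩ ++_) (conjugate w)
conjugate (b ∷ w) = cong (τ³⟨ b ∷ [] ⟩ ++_) (conjugate w)
conjugate (c ∷ w) = cong (τ³⟨ c ∷ [] ⟩ ++_) (conjugate w)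

θ-c∷ : ∀ p → θ ⟨ c ∷ p ⟩ ≡ c ∷ τ³⟨ p ⟩ ++ aba
θ-c∷ p = ∷-injectiveʳ (∷-injectiveʳ (∷-injectiveʳ (conjugate (c ∷ p))))

c·𝐓-fixed : IsFixedPoint θ (c · 𝐓)
c·𝐓-fixed n = trans (sym (⊑-‼ in-image long)) (⊑-‼ in-c·𝐓 long)
  where
  p : List Letter
  p = iter τ a n

  p⊑𝐓 : p ⊑ 𝐓
  p⊑𝐓 = iter-⊑ τ a τ-prolongable n

  in-image : c ∷ τ³⟨ p ⟩ ⊑ θ ⟨ c · 𝐓 ⟩∞
  in-image = ⊑-++ˡ (c ∷ τ³⟨ p ⟩)
    (subst (_⊑ θ ⟨ c · 𝐓 ⟩∞) (θ-c∷ p) (⊑-image θ {w = c · 𝐓} (refl ∷ p⊑𝐓)))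

  in-c·𝐓 : c ∷ τ³⟨ p ⟩ ⊑ c · 𝐓
  in-c·𝐓 = refl ∷ iter-⊑ τ a τ-prolongable (3 + n)

  long : n < length (c ∷ τ³⟨ p ⟩)
  long = ≤-trans (m≤n+m _ 3) (m≤n⇒m≤1+n (iter-length τ a τ-prolongable (3 + n)))

theorem2 : Θ ≗ c · 𝐓
theorem2 n = sym (Θ-unique (c · 𝐓) c·𝐓-fixed n)
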